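{- Let $\alpha$ be the arboricity of $G$ and let $\zeta$ be a motif with $k$ vertices having a $c$-dense segmentation $\sigma_2\subseteq\sigma_3\subseteq\dots\subseteq\sigma_k=\zeta$. Then for every $2\le i\le k$, $$\sum_{g\in\mathcal G(\sigma_i)}D(g)\ \le\ 2m\cdot\big((c+1)\,\alpha\big)^{\,i-1-c}\cdot n^{c}.$$
   Context: $G=(V,E)$ is a finite simple undirected graph, $n=|V|$, $m=|E|$, with a fixed total order $\prec$ on $V$. $N(v)$ is the neighbourhood of $v$ and $N(S)=\bigcup_{v\in S}N(v)$ for $S\subseteq V$. The arboricity of $G$ is the minimum number of forests into which $E$ can be partitioned. For a graph $\sigma$, $\mathcal G(\sigma)$ is the set of induced subgraphs of $G$ isomorphic to $\sigma$. A segmentation of a graph $\zeta$ on $k$ vertices is a sequence $\sigma_2\subseteq\sigma_3\subseteq\dots\subseteq\sigma_k=\zeta$ of connected induced subgraphs of $\zeta$ with $|\sigma_i|=i$. It is $c$-dense if each vertex of $\sigma_i$ has degree at least $i-1-c$ in $\sigma_i$, for every $i$. For $g\in\mathcal G(\sigma_i)$, the representative $R(g)$ is the set $S$ of $c+1$ vertices of $g$ minimizing $|N(S)|$ (ties broken lexicographically via $\prec$); if $g$ has fewer than $c+1$ vertices, $R(g)$ is the whole vertex set of $g$. The degree of $g$ is $D(g)=|N(R(g))|$.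
   Formalization: The exponent i−1−c is read as max(i−1−c, 0); for i < c+1 the literal negative exponent makes the inequality false (G = K_4, σ_2 = K_2, c = 3, i = 2 gives 24 on the left and 12 on the right). -}

module Defs where

open import Level using (0ℓ)
open import Data.Nat using (ℕ; zero; suc; _∸_; _≤_; _<_; _≟_; _<?_)
open import Data.Fin using (Fin; zero; suc; funToFin; finToFun)
import Data.Fin as Fin
open import Data.Fin.Properties using (all?; any?; finToFun-funToFin)
open import Data.Fin.Subset using (Subset; inside; outside; ⊤; ⋃; _∈_; _∉_; _⊆_; _∩_; ∣_∣)
open import Data.Fin.Subset.Properties using (_∈?_; _⊆?_)
open import Data.Bool using (if_then_else_)
open import Data.Vec using ([]; _∷_; tabulate; here; there)
open import Data.List using (List; []; _∷_; _++_; _∷ʳ_; map; filter; foldr; length; allFin; cartesianProduct)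
open import Data.List.Relation.Unary.Linked using (Linked)
open import Data.List.Relation.Unary.Unique.Propositional using (Unique)
open import Data.Product using (∃; ∃!; _×_; _,_; proj₁; proj₂)
open import Data.Sum using (_⊎_)
open import Function using (_∘_; _⇔_; _↔_; mk⇔; mk↔ₛ′; Equivalence; Inverse)
open import Relation.Binary using (Rel; Decidable; Symmetric; Irreflexive; IsStrictTotalOrder)
open import Relation.Binary.Construct.Closure.ReflexiveTransitive using (Star)
open import Relation.Binary.PropositionalEquality
  using (_≡_; refl; sym; trans; cong; subst₂)
open import Relation.Nullary using (¬_; ¬?; Dec; does)
open import Relation.Nullary.Decidable using (map′; _×-dec_; _⊎-dec_; _→-dec_)

record Graph (V : Set) : Set₁ where
  infix 4 _~_ _~?_
  field
    _~_     : V → V → Set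
    _~?_    : Decidable _~_
    ~-sym   : Symmetric _~_
    ~-irrefl : Irreflexive _≡_ _~_

open Graph public using () renaming (_~_ to Adj; _~?_ to adj?)

infix 8 _[_]

_[_] : ∀ {n} → Graph (Fin n) → (S : Subset n) → Graph (∃ (_∈ S))
G [ S ] = record
  { _~_      = λ u v → Adj G (proj₁ u) (proj₁ v)
  ; _~?_     = λ u v → adj? G (proj₁ u) (proj₁ v)
  ; ~-sym    = Graph.~-sym G
  ; ~-irrefl = λ u≡v → Graph.~-irrefl G (cong proj₁ u≡v)
  }

infix 4 _≅_

record _≅_ {V W : Set} (G : Graph V) (H : Graph W) : Set where
  field
    bijection : V ↔ W
    preserves : ∀ u v → Adj G u v ⇔ Adj H (Inverse.to bijection u) (Inverse.to bijection v)

Connected : ∀ {V} → Graph V → Set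
Connected G = ∀ u v → Star (Adj G) u v

record Cycle {V : Set} (G : Graph V) : Set where
  field
    start    : V
    rest     : List V
    distinct : Unique (start ∷ rest)
    long     : 3 ≤ length (start ∷ rest)
    closed   : Linked (Adj G) (start ∷ rest ∷ʳ start)

Acyclic : ∀ {V} → Graph V → Set
Acyclic G = ¬ Cycle G

-- The classes of the partition are given as spanning subgraphs; a class may
-- be empty, which does not affect the minimum number of classes.
record ForestPartition {V : Set} (G : Graph V) (β : ℕ) : Set₁ where
  field
    class     : Fin β → Graph V
    acyclic   : ∀ j → Acyclic (class j)
    sound     : ∀ j {u v} → Adj (class j) u v → Adj G u v
    partition : ∀ {u v} → Adj G u v → ∃! _≡_ λ j → Adj (class j) u v

IsArboricity : ∀ {V} → Graph V → ℕ → Set₁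
IsArboricity G α = ForestPartition G α × (∀ β → ForestPartition G β → α ≤ β)

module _ {n : ℕ} (G : Graph (Fin n)) where

  -- Each edge is counted once, at its increasingly ordered pair of ends.
  edgeCount : ℕ
  edgeCount = length (filter (λ (u , v) → (u Fin.<? v) ×-dec adj? G u v)
                             (cartesianProduct (allFin n) (allFin n)))

  N : Fin n → Subset n
  N v = tabulate (λ u → does (adj? G v u))

  NS : Subset n → Subset n
  NS S = ⋃ (map N (filter (_∈? S) (allFin n)))

-- Only the entries σ i with 2 ≤ i ≤ k are relevant; an induced subgraph of ζ
-- is given by its vertex set.
record IsSegmentation {k : ℕ} (ζ : Graph (Fin k)) (σ : ℕ → Subset k) : Set where
  field
    size      : ∀ i → 2 ≤ i → i ≤ k → ∣ σ i ∣ ≡ i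
    connected : ∀ i → 2 ≤ i → i ≤ k → Connected (ζ [ σ i ])
    monotone  : ∀ i → 2 ≤ i → i < k → σ i ⊆ σ (suc i)
    top       : σ k ≡ ⊤

-- ∣ N ζ v ∩ σ i ∣ is the degree of v in the induced subgraph ζ [ σ i ].
-- The condition is void when i - 1 - c is negative, so truncation is harmless.
IsDense : ∀ {k} → ℕ → Graph (Fin k) → (ℕ → Subset k) → Set
IsDense {k} c ζ σ =
  ∀ i → 2 ≤ i → i ≤ k → ∀ v → v ∈ σ i → i ∸ 1 ∸ c ≤ ∣ N ζ v ∩ σ i ∣

module _ {V W : Set} {a b : ℕ} (V↔a : V ↔ Fin a) (W↔b : W ↔ Fin b)
         (G : Graph V) (H : Graph W) where
  private
    module A = Inverse V↔a
    module B = Inverse W↔b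

    IsIso : (Fin a → Fin b) → (Fin b → Fin a) → Set
    IsIso f g = (∀ y → f (g y) ≡ y) × (∀ x → g (f x) ≡ x) ×
      (∀ x y → let u = A.from x ; v = A.from y
                   u′ = B.from (f x) ; v′ = B.from (f y) in
        (Adj G u v → Adj H u′ v′) × (Adj H u′ v′ → Adj G u v))

    isIso? : ∀ f g → Dec (IsIso f g)
    isIso? f g =
      all? (λ y → f (g y) Fin.≟ y) ×-dec all? (λ x → g (f x) Fin.≟ x) ×-dec
      all? (λ x → all? λ y →
        let d = adj? G (A.from x) (A.from y)
            e = adj? H (B.from (f x)) (B.from (f y)) in
        (d →-dec e) ×-dec (e →-dec d))

    Code : Set
    Code = ∃ λ p → ∃ λ q → IsIso (finToFun {b} {a} p) (finToFun {a} {b} q)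

    decode : Code → G ≅ H
    decode (p , q , fg , gf , pres) = record
      { bijection = mk↔ₛ′ (B.from ∘ f ∘ A.to) (A.from ∘ g ∘ B.to)
          (λ w → trans (cong (B.from ∘ f) (A.strictlyInverseˡ _))
                   (trans (cong B.from (fg _)) (B.strictlyInverseʳ w)))
          (λ v → trans (cong (A.from ∘ g) (B.strictlyInverseˡ _))
                   (trans (cong A.from (gf _)) (A.strictlyInverseʳ v)))
      ; preserves = λ u v → mk⇔
          (λ e → proj₁ (pres (A.to u) (A.to v))
            (subst₂ (Adj G) (sym (A.strictlyInverseʳ u)) (sym (A.strictlyInverseʳ v)) e))
          (λ e → subst₂ (Adj G) (A.strictlyInverseʳ u) (A.strictlyInverseʳ v)
            (proj₂ (pres (A.to u) (A.to v)) e))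
      }
      where
      f = finToFun {b} {a} p
      g = finToFun {a} {b} q

    encode : G ≅ H → Code
    encode iso = funToFin f , funToFin g ,
      (λ y → trans (f≗ _) (trans (cong f (g≗ y)) (fg y))) ,
      (λ x → trans (g≗ _) (trans (cong g (f≗ x)) (gf x))) ,
      (λ x y →
        let module P = Equivalence (_≅_.preserves iso (A.from x) (A.from y)) in
        (λ e → subst₂ (Adj H) (sym (back x)) (sym (back y)) (P.to e)) ,
        (λ e → P.from (subst₂ (Adj H) (back x) (back y) e)))
      where
      module I = Inverse (_≅_.bijection iso)
      f = B.to ∘ I.to ∘ A.from
      g = A.to ∘ I.from ∘ B.from
      f≗ = finToFun-funToFin f
      g≗ = finToFun-funToFin g
      fg : ∀ y → f (g y) ≡ y
      fg y = trans (cong (B.to ∘ I.to) (A.strictlyInverseʳ _))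
               (trans (cong B.to (I.strictlyInverseˡ _)) (B.strictlyInverseˡ y))
      gf : ∀ x → g (f x) ≡ x
      gf x = trans (cong (A.to ∘ I.from) (B.strictlyInverseʳ _))
               (trans (cong A.to (I.strictlyInverseʳ _)) (A.strictlyInverseˡ x))
      back : ∀ x → B.from (finToFun (funToFin f) x) ≡ I.to (A.from x)
      back x = trans (cong B.from (f≗ x)) (B.strictlyInverseʳ _)

  isomorphic? : Dec (G ≅ H)
  isomorphic? = map′ decode encode (any? λ p → any? λ q → isIso? (finToFun p) (finToFun q))

members↔ : ∀ {n} (S : Subset n) → ∃ (_∈ S) ↔ Fin ∣ S ∣
members↔ {n} S = mk↔ₛ′ (to S) (from S) (to∘from S) (from∘to S)
  where
  lift : ∀ {m s} {T : Subset m} → ∃ (_∈ T) → ∃ (_∈ (s ∷ T))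
  lift (v , v∈T) = suc v , there v∈T

  to : ∀ {m} (T : Subset m) → ∃ (_∈ T) → Fin ∣ T ∣
  to (inside  ∷ T) (zero  , _)         = zero
  to (inside  ∷ T) (suc v , there v∈T) = suc (to T (v , v∈T))
  to (outside ∷ T) (suc v , there v∈T) = to T (v , v∈T)

  from : ∀ {m} (T : Subset m) → Fin ∣ T ∣ → ∃ (_∈ T)
  from (inside  ∷ T) zero    = zero , here
  from (inside  ∷ T) (suc x) = lift (from T x)
  from (outside ∷ T) x       = lift (from T x)

  to∘from : ∀ {m} (T : Subset m) x → to T (from T x) ≡ x
  to∘from (inside  ∷ T) zero    = refl
  to∘from (inside  ∷ T) (suc x) = cong suc (to∘from T x)
  to∘from (outside ∷ T) x       = to∘from T x

  from∘to : ∀ {m} (T : Subset m) v → from T (to T v) ≡ v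
  from∘to (inside  ∷ T) (zero  , here)      = refl
  from∘to (inside  ∷ T) (suc v , there v∈T) = cong lift (from∘to T (v , v∈T))
  from∘to (outside ∷ T) (suc v , there v∈T) = cong lift (from∘to T (v , v∈T))

subsets : ∀ n → List (Subset n)
subsets zero    = [] ∷ []
subsets (suc n) = map (inside ∷_) (subsets n) ++ map (outside ∷_) (subsets n)

-- The vertex sets S of the induced subgraphs G [ S ] isomorphic to ζ [ T ].
𝒢 : ∀ {n k} → Graph (Fin n) → Graph (Fin k) → Subset k → List (Subset n)
𝒢 {n} G ζ T =
  filter (λ S → isomorphic? (members↔ S) (members↔ T) (G [ S ]) (ζ [ T ])) (subsets n)

module Representative {n : ℕ} (G : Graph (Fin n))
  {_≺_ : Rel (Fin n) 0ℓ} (≺-isStrictTotalOrder : IsStrictTotalOrder _≡_ _≺_) where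

  private
    module O = IsStrictTotalOrder ≺-isStrictTotalOrder

  -- For S and T of equal size, this is the lexicographic order on their
  -- ≺-increasing enumerations: v is the ≺-least vertex at which S and T differ.
  LexBefore : Subset n → Subset n → Set
  LexBefore S T = ∃ λ v → v ∈ S × v ∉ T ×
    (∀ u → u ≺ v → (u ∈ S → u ∈ T) × (u ∈ T → u ∈ S))

  lexBefore? : Decidable LexBefore
  lexBefore? S T = any? λ v → (v ∈? S) ×-dec ¬? (v ∈? T) ×-dec
    all? (λ u → (u O.<? v) →-dec
      (((u ∈? S) →-dec (u ∈? T)) ×-dec ((u ∈? T) →-dec (u ∈? S))))

  Better : Subset n → Subset n → Set
  Better S T = ∣ NS G S ∣ < ∣ NS G T ∣ ⊎
               (∣ NS G S ∣ ≡ ∣ NS G T ∣ × LexBefore S T)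

  better? : Decidable Better
  better? S T = (∣ NS G S ∣ <? ∣ NS G T ∣) ⊎-dec
                ((∣ NS G S ∣ ≟ ∣ NS G T ∣) ×-dec lexBefore? S T)

  best : Subset n → List (Subset n) → Subset n
  best = foldr (λ S T → if does (better? S T) then S else T)

  candidates : ℕ → Subset n → List (Subset n)
  candidates c g = filter (λ S → (S ⊆? g) ×-dec (∣ S ∣ ≟ suc c)) (subsets n)

  -- There is no candidate exactly when g has fewer than c + 1 vertices.
  R : ℕ → Subset n → Subset n
  R c g with candidates c g
  ... | []     = g
  ... | S ∷ Ss = best S Ss

  D : ℕ → Subset n → ℕ
  D c g = ∣ NS G (R c g) ∣

{-# OPTIONS --safe #-}
module Submission where

-- Every forest can be oriented from child to parent, so the edges of G become
-- arcs with at most α out of each vertex. A copy of σᵢ in which every vertex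
-- misses at most c others splits into c + 1 directed paths (if i ≤ c then into
-- i single vertices): a further vertex is adjacent to all of some path, and
-- fits into it as in the proof that a tournament has a Hamiltonian path. Hence
-- the copy is determined by the heads of its paths and, for each of the other
-- i - 1 - c vertices, one of the c + 1 current path ends and one of its α
-- out-neighbours. Since R minimizes |N(S)|, D is at most the sum of the degrees
-- of the heads, and each vertex v is a head of at most
-- n ^ c * ((c + 1) * α) ^ (i - 1 - c) copies; summing the degree of v over all v
-- gives 2m.

open import Defs
open import Level using (Level)
open import Data.Nat using (ℕ; pred; zero; suc; _+_; _*_; _∸_; _^_; _≤_; _<?_; _≤?_; _≟_; _⊓_; z≤n; s≤s)
open import Data.Nat.Properties hiding (_≟_; _≤?_; _<?_)
open import Data.Nat.ListAction using (sum)
open import Data.Bool using (true; false; if_then_else_)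
import Data.Bool as Bool
open import Data.Fin using (Fin; zero; suc)
import Data.Fin as Fin
import Data.Fin.Properties as Fin
open import Data.Fin.Properties using (injective⇒≤)
open import Data.Fin.Subset using (Subset; ∣_∣; _∪_; _∩_; ⋃) renaming (_∈_ to _∈ˢ_; _⊆_ to _⊆ˢ_)
open import Data.Fin.Subset.Properties using (⊆-antisym; ∣⊥∣≡0; p⊂q⇒∣p∣<∣q∣; p⊆q⇒∣p∣≤∣q∣; _⊆?_; x∈p∩q⁺; x∈p∩q⁻) renaming (_∈?_ to _∈ˢ?_)
open import Data.List using (List; []; _∷_; _++_; _∷ʳ_; map; filter; length; lookup; allFin; cartesianProduct; concatMap; take; drop)
open import Data.List.Properties hiding (++-assoc; ++-identityʳ)
import Data.List.Properties as List
open import Data.List.Membership.Propositional using (_∈_; _∉_; find; lose)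
open import Data.List.Membership.Propositional.Properties
open import Data.List.Relation.Unary.Any using (here; there; any?)
open import Data.List.Relation.Unary.Any.Properties using (lookup-index)
open import Data.List.Relation.Unary.All as All using (All; []; _∷_)
import Data.List.Relation.Unary.All.Properties as All
open import Data.List.Relation.Unary.AllPairs using ([]; _∷_)
open import Data.List.Relation.Unary.Linked using (Linked; []; [-]; _∷_)
open import Data.List.Relation.Unary.Unique.Propositional using (Unique)
open import Data.List.Relation.Unary.Unique.Propositional.Properties
  using () renaming (map⁺ to Unique-map⁺; ++⁺ to Unique-++⁺; filter⁺ to Unique-filter⁺; allFin⁺ to Unique-allFin; cartesianProduct⁺ to Unique-cartesianProduct)
open import Data.List.Relation.Binary.Subset.Propositional using (_⊆_)
open import Data.List.Relation.Binary.Permutation.Propositional using (_↭_; ↭-refl; ↭-reflexive; ↭-sym; ↭-trans; ↭⇒↭ₛ; prep)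
import Data.List.Relation.Binary.Permutation.Propositional as Perm
open import Data.List.Relation.Binary.Permutation.Propositional.Properties
open import Data.Product using (∃; ∃₂; _×_; _,_; proj₁; proj₂; swap)
open import Data.Sum using (_⊎_; inj₁; inj₂; [_,_]′)
import Data.Vec.Properties as Vec
open import Data.Vec as Vec using (tabulate)
open import Data.Vec.Properties using ([]=⇒lookup; lookup⇒[]=; lookup∘tabulate)
open import Data.Vec.Properties.WithK using ([]=-irrelevant)
open import Function using (_∘_; Injection; Inverse; Equivalence; id)
open import Function.Properties.Inverse using (↔⇒↣; ↔-sym)
open import Relation.Binary using (DecidableEquality; IsStrictTotalOrder; tri<; tri≈; tri>)
import Relation.Binary as B
open import Relation.Binary.PropositionalEquality
  using (_≡_; refl; sym; trans; cong; cong₂; subst; subst₂; setoid; module ≡-Reasoning)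
open import Relation.Nullary using (¬_; ¬?; Dec; yes; no; does; contradiction)
open import Relation.Nullary.Decidable using (dec-true; decidable-stable; _×-dec_)
open import Relation.Unary using (Pred; Decidable)
open import Algebra.Properties.CommutativeSemigroup +-commutativeSemigroup using (x∙yz≈y∙xz)

-- Counting in lists: pigeonhole and double counting.

private
  variable
    A B : Set
    p q : Level
    xs ys : List A

lookup-injective : Unique xs → ∀ {i j} → lookup xs i ≡ lookup xs j → i ≡ j
lookup-injective (_ ∷ _)   {zero}  {zero}  _  = refl
lookup-injective (x∉ ∷ _)  {zero}  {suc j} eq = contradiction eq (All.lookup x∉ (∈-lookup j))
lookup-injective (x∉ ∷ _)  {suc i} {zero}  eq = contradiction (sym eq) (All.lookup x∉ (∈-lookup i))
lookup-injective (_ ∷ xs!) {suc i} {suc j} eq = cong suc (lookup-injective xs! eq)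

-- Pigeonhole: each index of `xs` is sent to a position of the same value in `ys`, and this map is
-- injective because `xs` has no repetitions.
Unique-⊆-length : Unique xs → xs ⊆ ys → length xs ≤ length ys
Unique-⊆-length {xs = xs} {ys = ys} xs! xs⊆ys = injective⇒≤ λ {i} {j} eq → lookup-injective xs!
  (trans (lookup-index (pos i)) (trans (cong (lookup ys) eq) (sym (lookup-index (pos j)))))
  where
  pos : ∀ i → lookup xs i ∈ ys
  pos i = xs⊆ys (∈-lookup i)

Unique-++⁻ˡ : ∀ xs → Unique (xs ++ ys) → Unique xs
Unique-++⁻ˡ []       _        = []
Unique-++⁻ˡ (x ∷ xs) (x∉ ∷ u) = All.++⁻ˡ xs x∉ ∷ Unique-++⁻ˡ xs u

Unique-resp-↭ : xs ↭ ys → Unique xs → Unique ys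
Unique-resp-↭ xs↭ys = P.Unique-resp-↭ (↭⇒↭ₛ xs↭ys)
  where
  import Data.List.Relation.Binary.Permutation.Setoid.Properties (setoid _) as P

length-filter-complement : ∀ {P : Pred A p} (P? : Decidable P) xs →
  length (filter P? xs) + length (filter (¬? ∘ P?) xs) ≡ length xs
length-filter-complement P? []       = refl
length-filter-complement P? (x ∷ xs) with P? x
... | yes _ = cong suc (length-filter-complement P? xs)
... | no  _ = trans (+-suc _ _) (cong suc (length-filter-complement P? xs))

module _ {P : Pred A p} {Q : Pred A q} (P? : Decidable P) (Q? : Decidable Q) where

  sum-map-filter-mono : ∀ (f : A → ℕ) → (∀ {x} → P x → Q x) → ∀ xs →
    sum (map f (filter P? xs)) ≤ sum (map f (filter Q? xs))
  sum-map-filter-mono f P⇒Q []       = z≤n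
  sum-map-filter-mono f P⇒Q (x ∷ xs) with P? x | Q? x
  ... | yes _  | yes _  = +-monoʳ-≤ (f x) (sum-map-filter-mono f P⇒Q xs)
  ... | yes px | no ¬qx = contradiction (P⇒Q px) ¬qx
  ... | no _   | yes _  = ≤-trans (sum-map-filter-mono f P⇒Q xs) (m≤n+m _ (f x))
  ... | no _   | no _   = sum-map-filter-mono f P⇒Q xs

sum-map-mono : ∀ {f g : A → ℕ} xs → (∀ {x} → x ∈ xs → f x ≤ g x) → sum (map f xs) ≤ sum (map g xs)
sum-map-mono []       f≤g = z≤n
sum-map-mono (x ∷ xs) f≤g = +-mono-≤ (f≤g (here refl)) (sum-map-mono xs (f≤g ∘ there))

sum-map-*ʳ : ∀ (f : A → ℕ) c xs → sum (map (λ x → f x * c) xs) ≡ sum (map f xs) * c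
sum-map-*ʳ f c []       = refl
sum-map-*ʳ f c (x ∷ xs) = trans (cong (f x * c +_) (sum-map-*ʳ f c xs)) (sym (*-distribʳ-+ c (f x) _))

module _ {R : A → B → Set} (R? : B.Decidable R) (f : B → ℕ) where

  private
    count : List A → B → ℕ
    count xs y = length (filter (λ x → R? x y) xs)

  sum-count-∷ : ∀ x xs ys → sum (map (λ y → f y * count (x ∷ xs) y) ys)
    ≡ sum (map f (filter (R? x) ys)) + sum (map (λ y → f y * count xs y) ys)
  sum-count-∷ x xs []       = refl
  sum-count-∷ x xs (y ∷ ys) with R? x y
  ... | yes _ = begin
    f y * suc a + _             ≡⟨ cong₂ _+_ (*-suc (f y) a) (sum-count-∷ x xs ys) ⟩
    (f y + f y * a) + (b + c)   ≡⟨ +-assoc (f y) _ _ ⟩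
    f y + (f y * a + (b + c))   ≡⟨ cong (f y +_) (x∙yz≈y∙xz (f y * a) b c) ⟩
    f y + (b + (f y * a + c))   ≡⟨ +-assoc (f y) _ _ ⟨
    (f y + b) + (f y * a + c)   ∎
    where
    open ≡-Reasoning
    a = count xs y
    b = sum (map f (filter (R? x) ys))
    c = sum (map (λ y → f y * count xs y) ys)
  ... | no _ = begin
    f y * a + _       ≡⟨ cong (f y * a +_) (sum-count-∷ x xs ys) ⟩
    f y * a + (b + c) ≡⟨ x∙yz≈y∙xz (f y * a) b c ⟩
    b + (f y * a + c) ∎
    where
    open ≡-Reasoning
    a = count xs y
    b = sum (map f (filter (R? x) ys))
    c = sum (map (λ y → f y * count xs y) ys)

  -- Both sides add `f y` over all pairs related by `R`, once grouped by `x` and once by `y`;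
  -- `sum-count-∷` adds a single row.
  double-count : ∀ xs ys → sum (map (λ x → sum (map f (filter (R? x) ys))) xs)
    ≡ sum (map (λ y → f y * count xs y) ys)
  double-count []       ys = sym (trans (sum-map-*ʳ f 0 ys) (*-zeroʳ (sum (map f ys))))
  double-count (x ∷ xs) ys = trans (cong (_ +_) (double-count xs ys)) (sym (sum-count-∷ x xs ys))

length-filter-map : ∀ {P : Pred B p} (P? : Decidable P) (f : A → B) xs →
  length (filter P? (map f xs)) ≡ length (filter (P? ∘ f) xs)
length-filter-map P? f []       = refl
length-filter-map P? f (x ∷ xs) with P? (f x)
... | yes _ = cong suc (length-filter-map P? f xs)
... | no  _ = length-filter-map P? f xs

length-filter-cartesianProduct : ∀ {P : Pred (A × B) p} (P? : Decidable P) xs ys →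
  length (filter P? (cartesianProduct xs ys)) ≡ sum (map (λ x → length (filter (λ y → P? (x , y)) ys)) xs)
length-filter-cartesianProduct P? []       ys = refl
length-filter-cartesianProduct P? (x ∷ xs) ys = begin
  length (filter P? (map (x ,_) ys ++ cartesianProduct xs ys))
    ≡⟨ cong length (filter-++ P? (map (x ,_) ys) _) ⟩
  length (filter P? (map (x ,_) ys) ++ filter P? (cartesianProduct xs ys))
    ≡⟨ length-++ (filter P? (map (x ,_) ys)) ⟩
  _ ≡⟨ cong₂ _+_ (length-filter-map P? (x ,_) ys) (length-filter-cartesianProduct P? xs ys) ⟩
  _ ∎
  where open ≡-Reasoning

-- Finite subsets and their duplicate-free enumerations.

module _ {n : ℕ} where

  ∈-tabulate-does⁺ : ∀ {P : Pred (Fin n) p} (P? : Decidable P) {x} → P x → x ∈ˢ tabulate (does ∘ P?)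
  ∈-tabulate-does⁺ P? {x} px = lookup⇒[]= x _ (trans (lookup∘tabulate (does ∘ P?) x) (dec-true (P? x) px))

  ∈-tabulate-does⁻ : ∀ {P : Pred (Fin n) p} (P? : Decidable P) {x} → x ∈ˢ tabulate (does ∘ P?) → P x
  ∈-tabulate-does⁻ P? {x} x∈
    with P? x | trans (sym (lookup∘tabulate (does ∘ P?) x)) ([]=⇒lookup x∈)
  ... | yes px | _  = px
  ... | no _   | ()

  open import Data.List.Membership.DecPropositional {A = Fin n} Fin._≟_ using (_∈?_)

  fromList : List (Fin n) → Subset n
  fromList xs = tabulate (does ∘ (_∈? xs))

  ∈-fromList⁺ : ∀ {x xs} → x ∈ xs → x ∈ˢ fromList xs
  ∈-fromList⁺ {xs = xs} = ∈-tabulate-does⁺ (_∈? xs)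

  ∈-fromList⁻ : ∀ {x xs} → x ∈ˢ fromList xs → x ∈ xs
  ∈-fromList⁻ {xs = xs} = ∈-tabulate-does⁻ (_∈? xs)

  -- Going through `members↔` makes the number of entries `∣ S ∣` by construction, with uniqueness
  -- coming from injectivity of the bijection.
  elements : Subset n → List (Fin n)
  elements S = map (proj₁ ∘ Inverse.from (members↔ S)) (allFin ∣ S ∣)

  length-elements : ∀ S → length (elements S) ≡ ∣ S ∣
  length-elements S = trans (length-map _ (allFin ∣ S ∣)) (length-tabulate id)

  members-≡ : ∀ {S : Subset n} {u v : ∃ (_∈ˢ S)} → proj₁ u ≡ proj₁ v → u ≡ v
  members-≡ {u = u , u∈S} {.u , v∈S} refl = cong (u ,_) ([]=-irrelevant u∈S v∈S)

  Unique-elements : ∀ S → Unique (elements S)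
  Unique-elements S = Unique-map⁺ (Injection.injective (↔⇒↣ (↔-sym (members↔ S))) ∘ members-≡) (Unique-allFin _)

  ∈-elements⁺ : ∀ {S x} → x ∈ˢ S → x ∈ elements S
  ∈-elements⁺ {S} x∈S = subst (_∈ elements S) (cong proj₁ (I.strictlyInverseʳ (_ , x∈S)))
    (∈-map⁺ _ (∈-allFin (I.to (_ , x∈S))))
    where module I = Inverse (members↔ S)

  ∈-elements⁻ : ∀ {S x} → x ∈ elements S → x ∈ˢ S
  ∈-elements⁻ {S} x∈ with i , _ , refl ← ∈-map⁻ _ x∈ = proj₂ (Inverse.from (members↔ S) i)

  ∣fromList∣ : ∀ {xs} → Unique xs → ∣ fromList xs ∣ ≡ length xs
  ∣fromList∣ {xs} xs! = trans (sym (length-elements S)) (≤-antisym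
    (Unique-⊆-length {ys = xs} (Unique-elements S) (∈-fromList⁻ ∘ ∈-elements⁻ {S = S}))
    (Unique-⊆-length xs! (∈-elements⁺ {S = S} ∘ ∈-fromList⁺)))
    where S = fromList xs

∣p∪q∣≤∣p∣+∣q∣ : ∀ {n} (p q : Subset n) → ∣ p ∪ q ∣ ≤ ∣ p ∣ + ∣ q ∣
∣p∪q∣≤∣p∣+∣q∣ Vec.[] Vec.[] = z≤n
∣p∪q∣≤∣p∣+∣q∣ (true  Vec.∷ p) (true  Vec.∷ q) = s≤s (≤-trans (∣p∪q∣≤∣p∣+∣q∣ p q) (+-monoʳ-≤ ∣ p ∣ (n≤1+n _)))
∣p∪q∣≤∣p∣+∣q∣ (true  Vec.∷ p) (false Vec.∷ q) = s≤s (∣p∪q∣≤∣p∣+∣q∣ p q)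
∣p∪q∣≤∣p∣+∣q∣ (false Vec.∷ p) (true  Vec.∷ q) = ≤-trans (s≤s (∣p∪q∣≤∣p∣+∣q∣ p q)) (≤-reflexive (sym (+-suc ∣ p ∣ ∣ q ∣)))
∣p∪q∣≤∣p∣+∣q∣ (false Vec.∷ p) (false Vec.∷ q) = ∣p∪q∣≤∣p∣+∣q∣ p q

∣⋃∣≤sum : ∀ {n} (ps : List (Subset n)) → ∣ ⋃ ps ∣ ≤ sum (map ∣_∣ ps)
∣⋃∣≤sum {n} []       = ≤-reflexive (∣⊥∣≡0 n)
∣⋃∣≤sum     (p ∷ ps) = ≤-trans (∣p∪q∣≤∣p∣+∣q∣ p (⋃ ps)) (+-monoʳ-≤ ∣ p ∣ (∣⋃∣≤sum ps))

-- Neighbourhood sizes and the degree sum.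

module _ {n : ℕ} (G : Graph (Fin n)) where

  ∣NS∣≤sum : ∀ S → ∣ NS G S ∣ ≤ sum (map (∣_∣ ∘ N G) (filter (_∈ˢ? S) (allFin n)))
  ∣NS∣≤sum S = ≤-trans (∣⋃∣≤sum (map (N G) vs)) (≤-reflexive (cong sum (sym (map-∘ vs))))
    where vs = filter (_∈ˢ? S) (allFin n)

  ∣N∣≤ : ∀ v → ∣ N G v ∣ ≤ length (filter (adj? G v) (allFin n))
  ∣N∣≤ v = ≤-trans (≤-reflexive (sym (length-elements (N G v)))) (Unique-⊆-length (Unique-elements (N G v))
    λ u∈ → ∈-filter⁺ (adj? G v) (∈-allFin _) (∈-tabulate-does⁻ (adj? G v) (∈-elements⁻ u∈)))

  -- Degrees count ordered adjacent pairs, and by irreflexivity such a pair is either an increasing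
  -- one, as counted by `edgeCount`, or the reversal of one.
  handshake : sum (map (∣_∣ ∘ N G) (allFin n)) ≤ 2 * edgeCount G
  handshake = begin
    sum (map (∣_∣ ∘ N G) V)                                 ≤⟨ sum-map-mono V (λ {v} _ → ∣N∣≤ v) ⟩
    sum (map (λ v → length (filter (adj? G v) V)) V)        ≡⟨ length-filter-cartesianProduct arc? V V ⟨
    length (filter arc? (cartesianProduct V V))             ≤⟨ Unique-⊆-length (Unique-filter⁺ arc? (Unique-cartesianProduct (Unique-allFin n) (Unique-allFin n))) arc⊆ ⟩
    length (edges ++ map swap edges)                        ≡⟨ length-++ edges ⟩
    edgeCount G + length (map swap edges)                   ≡⟨ cong (edgeCount G +_) (trans (length-map swap edges) (sym (+-identityʳ _))) ⟩
    2 * edgeCount G                                         ∎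
    where
    open ≤-Reasoning
    V = allFin n
    arc? = λ ((u , v) : Fin n × Fin n) → adj? G u v
    edge? = λ ((u , v) : Fin n × Fin n) → (u Fin.<? v) ×-dec adj? G u v
    edges = filter edge? (cartesianProduct V V)
    arc⊆ : filter arc? (cartesianProduct V V) ⊆ edges ++ map swap edges
    arc⊆ {u , v} uv∈ with ∈-filter⁻ arc? {xs = cartesianProduct V V} uv∈
    ... | _ , u~v with Fin.<-cmp u v
    ... | tri< u<v _ _ = ∈-++⁺ˡ (∈-filter⁺ edge? (∈-cartesianProduct⁺ (∈-allFin u) (∈-allFin v)) (u<v , u~v))
    ... | tri≈ _ u≡v _ = contradiction u~v (Graph.~-irrefl G u≡v)
    ... | tri> _ _ v<u = ∈-++⁺ʳ edges (∈-map⁺ swap (∈-filter⁺ edge?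
      (∈-cartesianProduct⁺ (∈-allFin v) (∈-allFin u)) (v<u , Graph.~-sym G u~v)))

-- Leaves and parent functions of forests.

Linked-++⁻-∷ʳ : ∀ {R : A → A → Set} xs {y ys} → Linked R (xs ++ y ∷ ys) → Linked R (xs ∷ʳ y)
Linked-++⁻-∷ʳ []           _        = [-]
Linked-++⁻-∷ʳ (x ∷ [])     (r ∷ rs) = r ∷ [-]
Linked-++⁻-∷ʳ (x ∷ y ∷ xs) (r ∷ rs) = r ∷ Linked-++⁻-∷ʳ (y ∷ xs) rs

module _ {V : Set} (_≟_ : DecidableEquality V) (F : Graph V) (F-acyclic : Acyclic F) where

  open Graph F

  -- The vertex `y` is only an upper bound on the neighbours of `v` inside `xs`, so that an isolated
  -- vertex counts as a leaf too.
  Leaf : List V → Set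
  Leaf xs = ∃₂ λ v y → v ∈ xs × (∀ {u} → u ∈ xs → v ~ u → u ≡ y)

  -- If `w` occurred in `us`, the path from `u₀` through `u₁` up to `w`, closed by the edge between
  -- `w` and `u₀`, would be a cycle with at least three vertices.
  no-chord : ∀ {u₀ u₁ us w} → Unique (u₀ ∷ u₁ ∷ us) → Linked _~_ (u₀ ∷ u₁ ∷ us) → u₀ ~ w → w ∉ us
  no-chord {u₀} {u₁} {us} {w} u! ul u₀~w w∈us with as , bs , refl ← ∈-∃++ w∈us = F-acyclic record
    { start    = w
    ; rest     = u₀ ∷ u₁ ∷ as
    ; distinct = Unique-resp-↭ (++-comm (u₀ ∷ u₁ ∷ as) (w ∷ []))
        (Unique-++⁻ˡ ((u₀ ∷ u₁ ∷ as) ∷ʳ w) (subst Unique (sym (List.++-assoc (u₀ ∷ u₁ ∷ as) (w ∷ []) bs)) u!))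
    ; long     = s≤s (s≤s (s≤s z≤n))
    ; closed   = ~-sym u₀~w ∷ Linked-++⁻-∷ʳ (u₀ ∷ u₁ ∷ as) ul
    }

  -- A neighbour of the head other than its predecessor is not on the path, as F
  -- has no cycle, so the path can be extended until its head is a leaf.
  extend-to-leaf : ∀ xs fuel {u₀ u₁ us} → length xs ≤ fuel + length us →
    (u₀ ∷ u₁ ∷ us) ⊆ xs → Unique (u₀ ∷ u₁ ∷ us) → Linked _~_ (u₀ ∷ u₁ ∷ us) → Leaf xs
  extend-to-leaf xs zero bound us⊆ us! ul =
    -- The path has `length us + 2` distinct vertices, all in `xs`, whereas exhausted fuel means
    -- `length xs ≤ length us`.
    contradiction (≤-trans (n≤1+n _) (≤-trans (Unique-⊆-length us! us⊆) bound)) 1+n≰n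
  extend-to-leaf xs (suc fuel) {u₀} {u₁} {us} bound us⊆ us! ul
    with any? (λ w → (u₀ ~? w) ×-dec ¬? (w ≟ u₁)) xs
  ... | no ¬any = u₀ , u₁ , us⊆ (here refl) , λ {u} u∈ u₀~u →
    decidable-stable (u ≟ u₁) (λ u≢u₁ → ¬any (lose u∈ (u₀~u , u≢u₁)))
  ... | yes any with w , w∈ , u₀~w , w≢u₁ ← find any =
    extend-to-leaf xs fuel (≤-trans bound (≤-reflexive (sym (+-suc fuel _))))
      (λ { (here refl) → w∈ ; (there v∈) → us⊆ v∈ })
      (((λ w≡u₀ → ~-irrefl (sym w≡u₀) u₀~w) ∷ w≢u₁ ∷ All.¬Any⇒All¬ us (no-chord us! ul u₀~w)) ∷ us!)
      (~-sym u₀~w ∷ ul)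

  leaf : ∀ {x xs} → Leaf (x ∷ xs)
  leaf {x} {xs} with any? (x ~?_) (x ∷ xs)
  ... | no ¬any = x , x , here refl , λ u∈ x~u → contradiction (lose u∈ x~u) ¬any
  ... | yes any with w , w∈ , x~w ← find any =
    extend-to-leaf (x ∷ xs) (length (x ∷ xs)) (m≤m+n _ 0)
      (λ { (here refl) → w∈ ; (there (here refl)) → here refl ; (there (there ())) })
      (((λ w≡x → ~-irrefl (sym w≡x) x~w) ∷ []) ∷ [] ∷ []) (~-sym x~w ∷ [-])

  -- A leaf `v` is peeled off and `y`, its only possible neighbour, becomes its parent; every edge
  -- at `v` is then accounted for, and the remaining edges are handled recursively. The fuel bounds
  -- the length of the filtered list, which is not a structural subterm.
  parents : ∀ fuel xs → length xs ≤ fuel →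
    ∃ λ (parent : V → V) → ∀ {u v} → u ∈ xs → v ∈ xs → u ~ v → parent u ≡ v ⊎ parent v ≡ u
  parents _          []        _     = id , λ ()
  parents (suc fuel) xs@(_ ∷ _) bound with v , y , v∈ , v-leaf ← leaf {xs = drop 1 xs}
    with parent , spec ← parents fuel (filter (λ u → ¬? (u ≟ v)) xs)
           (≤-pred (≤-trans (filter-notAll (λ u → ¬? (u ≟ v)) xs (lose v∈ (λ v≢v → v≢v refl))) bound))
    = parent′ , spec′
    where
    ≢v? = λ u → ¬? (u ≟ v)
    parent′ : V → V
    parent′ u with u ≟ v
    ... | yes _ = y
    ... | no _  = parent u
    spec′ : ∀ {a b} → a ∈ xs → b ∈ xs → a ~ b → parent′ a ≡ b ⊎ parent′ b ≡ a
    spec′ {a} {b} a∈ b∈ a~b with a ≟ v | b ≟ v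
    ... | yes refl | _        = inj₁ (sym (v-leaf b∈ a~b))
    ... | no _     | yes refl = inj₂ (sym (v-leaf a∈ (~-sym a~b)))
    ... | no a≢v   | no b≢v   = spec (∈-filter⁺ ≢v? a∈ a≢v) (∈-filter⁺ ≢v? b∈ b≢v) a~b

module _ {n : ℕ} (G : Graph (Fin n)) where

  -- Total parent functions give each vertex `α` candidate out-neighbours. A value `parent j u` may
  -- fail to be adjacent to `u`, for instance at a root; such extra arcs can only enlarge a count of
  -- walks.
  Orientation : ℕ → Set
  Orientation α = ∃ λ (parent : Fin α → Fin n → Fin n) →
    ∀ {u v} → Adj G u v → ∃ λ j → parent j u ≡ v ⊎ parent j v ≡ u

  forests⇒orientation : ∀ {α} → ForestPartition G α → Orientation α
  forests⇒orientation {α} FP = (proj₁ ∘ forest) , λ {u} {v} u~v →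
    let j , u~ⱼv , _ = partition u~v in
    j , proj₂ (forest j) (∈-allFin u) (∈-allFin v) u~ⱼv
    where
    open ForestPartition FP
    forest = λ j → parents Fin._≟_ (class j) (acyclic j) _ (allFin n) ≤-refl

-- Partitions into directed paths.

Path : Set → Set
Path A = A × List A

vertices : Path A → List A
vertices (x , xs) = x ∷ xs

heads tails flat : List (Path A) → List A
heads = map proj₁
tails = concatMap proj₂
flat  = concatMap vertices

flat↭heads++tails : ∀ (ps : List (Path A)) → flat ps ↭ heads ps ++ tails ps
flat↭heads++tails []              = ↭-refl
flat↭heads++tails ((x , xs) ∷ ps) = prep x (↭-trans (++⁺ˡ xs (flat↭heads++tails ps)) (shifts xs (heads ps)))

flat-singletons : ∀ (xs : List A) → flat (map (_, []) xs) ≡ xs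
flat-singletons []       = refl
flat-singletons (x ∷ xs) = cong (x ∷_) (flat-singletons xs)

module _ {_~_ : A → A → Set} (_~?_ : B.Decidable _~_) {Arc : A → A → Set}
         (orient : ∀ {u v} → u ~ v → Arc u v ⊎ Arc v u) where

  IsDipath : Path A → Set
  IsDipath p = Linked Arc (vertices p)

  -- The vertex `w` moves along the path as long as arcs point into it, and stops before the first
  -- vertex to which it has an arc, or at the end.
  insert-after : ∀ {x w} ys → Arc x w → Linked Arc (x ∷ ys) → All (w ~_) ys →
    ∃ λ zs → Linked Arc (x ∷ zs) × zs ↭ w ∷ ys
  insert-after {w = w} [] xw _ _ = w ∷ [] , xw ∷ [-] , ↭-refl
  insert-after {w = w} (y ∷ ys) xw (xy ∷ ysl) (w~y ∷ w~ys) with orient w~y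
  ... | inj₁ wy = w ∷ y ∷ ys , xw ∷ wy ∷ ysl , ↭-refl
  ... | inj₂ yw with zs , zsl , zs↭ ← insert-after ys yw ysl w~ys =
    y ∷ zs , xy ∷ zsl , ↭-trans (prep y zs↭) (Perm.swap y w ↭-refl)

  insert : ∀ {w} p → IsDipath p → All (w ~_) (vertices p) →
    ∃ λ p′ → IsDipath p′ × vertices p′ ↭ w ∷ vertices p
  insert {w} (x , xs) pl (w~x ∷ w~xs) with orient w~x
  ... | inj₁ wx = (w , x ∷ xs) , wx ∷ pl , ↭-refl
  ... | inj₂ xw with ys , ysl , ys↭ ← insert-after xs xw pl w~xs =
    (x , ys) , ysl , ↭-trans (prep x ys↭) (Perm.swap x w ↭-refl)

  -- If `w` fits into no path by `insert`, every path contains a non-neighbour of `w`, and one from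
  -- each path gives the lower bound of the second alternative.
  insert-somewhere : ∀ w ps → All IsDipath ps →
    (∃ λ ps′ → length ps′ ≡ length ps × All IsDipath ps′ × flat ps′ ↭ w ∷ flat ps)
      ⊎ length ps ≤ length (filter (¬? ∘ (w ~?_)) (flat ps))
  insert-somewhere w [] [] = inj₂ z≤n
  insert-somewhere w (p ∷ ps) (pl ∷ psl) with All.all? (w ~?_) (vertices p)
  ... | yes w~p with p′ , p′l , p′↭ ← insert p pl w~p =
    inj₁ (p′ ∷ ps , refl , p′l ∷ psl , ++⁺ʳ (flat ps) p′↭)
  ... | no ¬w~p with insert-somewhere w ps psl
  ...   | inj₁ (ps′ , len , ps′l , ps′↭) = inj₁ (p ∷ ps′ , cong suc len , pl ∷ ps′l ,
            ↭-trans (++⁺ˡ (vertices p) ps′↭) (shift w (vertices p) (flat ps)))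
  ...   | inj₂ le = inj₂ (begin
            suc (length ps)                          ≤⟨ +-mono-≤ (filter-some ≁? (All.¬All⇒Any¬ (w ~?_) _ ¬w~p)) le ⟩
            length (filter ≁? (vertices p)) + length (filter ≁? (flat ps)) ≡⟨ length-++ (filter ≁? (vertices p)) ⟨
            length (filter ≁? (vertices p) ++ filter ≁? (flat ps)) ≡⟨ cong length (filter-++ ≁? (vertices p) (flat ps)) ⟨
            length (filter ≁? (vertices p ++ flat ps)) ∎)
    where
    open ≤-Reasoning
    ≁? = ¬? ∘ (w ~?_)

  record DipathPartition (m : ℕ) (es : List A) : Set where
    field
      paths  : List (Path A)
      size   : length paths ≡ m
      linked : All IsDipath paths
      cover  : flat paths ↭ es

  -- The order of the paths is immaterial, so the one starting at `v` can be moved to the front. Any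
  -- head can thus play the role of the distinguished first one.
  headed-by : ∀ {m es v} (𝒫 : DipathPartition m es) → v ∈ heads (DipathPartition.paths 𝒫) →
    ∃₂ λ xs ps → length ((v , xs) ∷ ps) ≡ m × All IsDipath ((v , xs) ∷ ps) × flat ((v , xs) ∷ ps) ↭ es
  headed-by 𝒫 v∈
    with (v , xs) , p∈ , refl ← ∈-map⁻ proj₁ v∈
    with as , bs , refl ← ∈-∃++ p∈ =
    xs , as ++ bs , trans (sym (↭-length moved)) size , All-resp-↭ moved linked ,
    ↭-trans (++⁺ˡ (v ∷ xs) (↭-reflexive (concatMap-++ vertices as bs)))
      (↭-trans (shifts (v ∷ xs) (flat as))
        (↭-trans (↭-reflexive (sym (concatMap-++ vertices as ((v , xs) ∷ bs)))) cover))
    where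
    open DipathPartition 𝒫
    moved = shift (v , xs) as bs

  -- A new vertex has fewer than m non-neighbours among the m paths, hence is
  -- adjacent to all of some path and, as in a tournament, fits into it.
  dipath-partition : (~-irrefl : ∀ {u} → ¬ u ~ u) → ∀ {m es} → m ≤ length es →
    (∀ {w} → w ∈ es → length es ≤ length (filter (w ~?_) es) + m) → DipathPartition m es
  dipath-partition ~-irrefl {m} {es} m≤ dense =
    grow (drop m es) (map (_, []) (take m es))
      -- The first `m` vertices serve as one-vertex paths; the others are inserted one at a time.
      (trans (length-map _ (take m es)) (trans (length-take m es) (m≤n⇒m⊓n≡m m≤)))
      (All.map⁺ (All.universal (λ _ → [-]) (take m es)))
      (↭-reflexive (trans (cong (_++ drop m es) (flat-singletons (take m es))) (take++drop≡id m es)))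
    where
    grow : ∀ rest ps → length ps ≡ m → All IsDipath ps → flat ps ++ rest ↭ es → DipathPartition m es
    grow [] ps len psl ps↭ = record
      { paths = ps ; size = len ; linked = psl ; cover = ↭-trans (↭-sym (++-identityʳ (flat ps))) ps↭ }
    grow (w ∷ rest) ps len psl ps↭ with insert-somewhere w ps psl
    ... | inj₁ (ps′ , len′ , ps′l , ps′↭) = grow rest ps′ (trans len′ len) ps′l
      (↭-trans (++⁺ʳ rest ps′↭) (↭-trans (↭-sym (shift w (flat ps) rest)) ps↭))
    ... | inj₂ le = contradiction bound 1+n≰n
      where
      open ≤-Reasoning
      ≁? = ¬? ∘ (w ~?_)
      deg = length (filter (w ~?_) es)
      -- The extra 1 is `w` itself: it is not its own neighbour and lies outside the current paths,
      -- so it has at least `m + 1` non-neighbours in `es`, while density allows only `m`.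
      bound : suc (deg + m) ≤ deg + m
      bound = begin
        suc (deg + m)                           ≡⟨ cong (λ l → suc (deg + l)) len ⟨
        suc (deg + length ps)                   ≡⟨ +-suc deg _ ⟨
        deg + suc (length ps)                   ≡⟨ cong (deg +_) (+-comm 1 (length ps)) ⟩
        deg + (length ps + 1)                   ≤⟨ +-monoʳ-≤ deg (+-mono-≤ le (filter-some ≁? (here ~-irrefl))) ⟩
        deg + (length (filter ≁? (flat ps)) + length (filter ≁? (w ∷ rest)))
                                                ≡⟨ cong (deg +_) (length-++ (filter ≁? (flat ps))) ⟨
        deg + length (filter ≁? (flat ps) ++ filter ≁? (w ∷ rest))
                                                ≡⟨ cong (λ l → deg + length l) (filter-++ ≁? (flat ps) (w ∷ rest)) ⟨
        deg + length (filter ≁? (flat ps ++ w ∷ rest)) ≡⟨ cong (deg +_) (↭-length (filter-↭ ≁? ps↭)) ⟩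
        deg + length (filter ≁? es)             ≡⟨ length-filter-complement (w ~?_) es ⟩
        length es                               ≤⟨ dense (∈-resp-↭ ps↭ (∈-++⁺ʳ (flat ps) (here refl))) ⟩
        deg + m                                 ∎

-- Enumeration of walks and tuples.

length-concatMap : ∀ (f : A → List B) {c} xs → (∀ {x} → x ∈ xs → length (f x) ≤ c) →
  length (concatMap f xs) ≤ length xs * c
length-concatMap f []       le = z≤n
length-concatMap f (x ∷ xs) le = ≤-trans (≤-reflexive (length-++ (f x)))
  (+-mono-≤ (le (here refl)) (length-concatMap f xs (le ∘ there)))

module _ {A : Set} {α : ℕ} (next : Fin α → A → A) where

  Step : A → A → Set
  Step u v = ∃ λ j → next j u ≡ v

  -- The tails, concatenated, of walks starting at the given vertices and having
  -- r steps in total: either the first walk makes a step or it is complete.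
  walks : ℕ → List A → List (List A)
  walks zero    _        = [] ∷ []
  walks (suc r) []       = []
  walks (suc r) (u ∷ us) =
    concatMap (λ j → map (next j u ∷_) (walks r (next j u ∷ us))) (allFin α) ++ walks (suc r) us

  -- With `b = length us * α`, a first step leaves `α * (α + b) ^ r` possibilities and completing
  -- the first walk leaves `b ^ suc r`; since `b ≤ α + b`, the total is at most `(α + b) ^ suc r`.
  length-walks : ∀ r us → length (walks r us) ≤ (length us * α) ^ r
  length-walks zero    us       = ≤-refl
  length-walks (suc r) []       = z≤n
  length-walks (suc r) (u ∷ us) = begin
    length (concatMap f (allFin α) ++ walks (suc r) us)         ≡⟨ length-++ (concatMap f (allFin α)) ⟩
    length (concatMap f (allFin α)) + length (walks (suc r) us) ≤⟨ +-mono-≤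
      (length-concatMap f (allFin α) λ {j} _ → ≤-trans (≤-reflexive (length-map _ (walks r _))) (length-walks r (next j u ∷ us)))
      (length-walks (suc r) us) ⟩
    length (allFin α) * s ^ r + (b * b ^ r)                     ≡⟨ cong (λ l → l * s ^ r + b * b ^ r) (length-tabulate {n = α} id) ⟩
    α * s ^ r + b * b ^ r                                       ≤⟨ +-monoʳ-≤ (α * s ^ r) (*-monoʳ-≤ b (^-monoˡ-≤ r (m≤n+m b α))) ⟩
    α * s ^ r + b * s ^ r                                       ≡⟨ *-distribʳ-+ (s ^ r) α b ⟨
    s * s ^ r                                                   ∎
    where
    open ≤-Reasoning
    b = length us * α
    s = α + b
    f = λ j → map (next j u ∷_) (walks r (next j u ∷ us))

  tails∈walks : ∀ ps → All (Linked Step ∘ vertices) ps → tails ps ∈ walks (length (tails ps)) (heads ps)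

  tails∈walks-∷ : ∀ x xs ps → Linked Step (x ∷ xs) → All (Linked Step ∘ vertices) ps →
    xs ++ tails ps ∈ walks (length (xs ++ tails ps)) (x ∷ heads ps)

  tails∈walks []              []         = here refl
  tails∈walks ((x , xs) ∷ ps) (pl ∷ psl) = tails∈walks-∷ x xs ps pl psl

  -- `walks` inspects the number of steps before the vertices, so completing the first walk is a
  -- separate choice only if some later tail is nonempty.
  tails∈walks-∷ x [] ps _ psl with tails ps | tails∈walks ps psl
  ... | []    | _  = here refl
  ... | _ ∷ _ | t∈ = ∈-++⁺ʳ (concatMap _ (allFin α)) t∈
  tails∈walks-∷ x (y ∷ ys) ps ((j , refl) ∷ yl) psl = ∈-++⁺ˡ (∈-concatMap⁺ _
    (lose (∈-allFin j) (∈-map⁺ _ (tails∈walks-∷ y ys ps yl psl))))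

lists : List A → ℕ → List (List A)
lists as zero    = [] ∷ []
lists as (suc k) = concatMap (λ a → map (a ∷_) (lists as k)) as

length-lists : ∀ (as : List A) k → length (lists as k) ≤ length as ^ k
length-lists as zero    = ≤-refl
length-lists as (suc k) = length-concatMap _ as λ _ →
  ≤-trans (≤-reflexive (length-map _ (lists as k))) (length-lists as k)

∈-lists : ∀ {as : List A} xs → xs ⊆ as → xs ∈ lists as (length xs)
∈-lists []       _   = here refl
∈-lists (x ∷ xs) sub = ∈-concatMap⁺ _ (lose (sub (here refl)) (∈-map⁺ _ (∈-lists xs (sub ∘ there))))

∈-lists⇒length : ∀ (as : List A) k {xs} → xs ∈ lists as k → length xs ≡ k
∈-lists⇒length as zero    (here refl) = refl
∈-lists⇒length as (suc k) xs∈
  with a , _ , xs∈′ ← find (∈-concatMap⁻ (λ a → map (a ∷_) (lists as k)) {xs = as} xs∈)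
  with ys , ys∈ , refl ← ∈-map⁻ (a ∷_) xs∈′ = cong suc (∈-lists⇒length as k ys∈)

-- The list of all subsets, and comparison of cardinalities.

Unique-subsets : ∀ n → Unique (subsets n)
Unique-subsets zero    = [] ∷ []
Unique-subsets (suc n) = Unique-++⁺ (Unique-map⁺ Vec.∷-injectiveʳ (Unique-subsets n)) (Unique-map⁺ Vec.∷-injectiveʳ (Unique-subsets n))
  λ (p , q) → disjoint (∈-map⁻ _ p) (∈-map⁻ _ q)
  where
  disjoint : ∀ {v : Subset (suc n)} → (∃ λ S → S ∈ subsets n × v ≡ true Vec.∷ S) →
    ¬ (∃ λ S → S ∈ subsets n × v ≡ false Vec.∷ S)
  disjoint (_ , _ , refl) (_ , _ , ())

∈-subsets : ∀ {n} (S : Subset n) → S ∈ subsets n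
∈-subsets Vec.[]          = here refl
∈-subsets (true  Vec.∷ S) = ∈-++⁺ˡ (∈-map⁺ _ (∈-subsets S))
∈-subsets (false Vec.∷ S) = ∈-++⁺ʳ (map (true Vec.∷_) (subsets _)) (∈-map⁺ _ (∈-subsets S))

⊆∧∣∣≡⇒≡ : ∀ {n} {S T : Subset n} → S ⊆ˢ T → ∣ S ∣ ≡ ∣ T ∣ → S ≡ T
⊆∧∣∣≡⇒≡ {S = S} {T} S⊆T eq = ⊆-antisym S⊆T λ {x} x∈T → decidable-stable (x ∈ˢ? S)
  λ x∉S → <⇒≢ (p⊂q⇒∣p∣<∣q∣ (S⊆T , x , x∈T , x∉S)) eq

injection⇒∣∣≤ : ∀ {m n} {S : Subset m} {T : Subset n} (f : ∃ (_∈ˢ S) → ∃ (_∈ˢ T)) →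
  (∀ {x y} → f x ≡ f y → x ≡ y) → ∣ S ∣ ≤ ∣ T ∣
injection⇒∣∣≤ {S = S} {T} f f-inj = injective⇒≤ {f = Inverse.to (members↔ T) ∘ f ∘ Inverse.from (members↔ S)}
  (from-injective ∘ f-inj ∘ to-injective)
  where
  from-injective : ∀ {i j} → Inverse.from (members↔ S) i ≡ Inverse.from (members↔ S) j → i ≡ j
  from-injective = Injection.injective (↔⇒↣ (↔-sym (members↔ S)))
  to-injective : ∀ {i j} → Inverse.to (members↔ T) i ≡ Inverse.to (members↔ T) j → i ≡ j
  to-injective = Injection.injective (↔⇒↣ (members↔ T))

-- Transfer of size and degrees from the motif to its copies.

module _ {n k} (G : Graph (Fin n)) (ζ : Graph (Fin k)) {S : Subset n} {T : Subset k}
         (iso : G [ S ] ≅ ζ [ T ]) where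

  private
    module I = Inverse (_≅_.bijection iso)

    to-injective : ∀ {u v} → I.to u ≡ I.to v → u ≡ v
    to-injective = Injection.injective (↔⇒↣ (_≅_.bijection iso))

    from-injective : ∀ {u v} → I.from u ≡ I.from v → u ≡ v
    from-injective = Injection.injective (↔⇒↣ (↔-sym (_≅_.bijection iso)))

  ≅⇒∣∣≡ : ∣ S ∣ ≡ ∣ T ∣
  ≅⇒∣∣≡ = ≤-antisym (injection⇒∣∣≤ I.to to-injective) (injection⇒∣∣≤ I.from from-injective)

  -- The inverse isomorphism sends neighbours of the image of `w` inside `T` injectively to
  -- neighbours of `w` inside `S`. This carries density over to copies.
  ≅⇒degree : ∀ w → ∣ N ζ (proj₁ (I.to w)) ∩ T ∣ ≤ ∣ N G (proj₁ w) ∩ S ∣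
  ≅⇒degree w = injection⇒∣∣≤ f λ eq → members-≡ (cong proj₁ (from-injective (members-≡ (cong proj₁ eq))))
    where
    w′ = proj₁ (I.to w)
    f : ∃ (_∈ˢ N ζ w′ ∩ T) → ∃ (_∈ˢ N G (proj₁ w) ∩ S)
    f (x , x∈) = proj₁ u , x∈p∩q⁺ (∈-tabulate-does⁺ (adj? G (proj₁ w)) w~u , proj₂ u)
      where
      x∈T = proj₂ (x∈p∩q⁻ (N ζ w′) T x∈)
      u = I.from (x , x∈T)
      w~u : Adj G (proj₁ w) (proj₁ u)
      w~u = Equivalence.from (_≅_.preserves iso w u)
        (subst (Adj ζ w′) (cong proj₁ (sym (I.strictlyInverseˡ (x , x∈T))))
          (∈-tabulate-does⁻ (adj? ζ w′) (proj₁ (x∈p∩q⁻ (N ζ w′) T x∈))))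

-- Minimality of the representative.

module _ {n : ℕ} (G : Graph (Fin n)) {_≺_ : Fin n → Fin n → Set} (≺-sto : IsStrictTotalOrder _≡_ _≺_) where

  open Representative G ≺-sto

  -- A choice made by the lexicographic tie-break leaves `∣ NS G S ∣` and `∣ NS G T ∣` equal, so the
  -- chosen set is minimal in either case.
  pick-≤ : ∀ {S T} (better : Dec (Better S T)) → let U = if does better then S else T in
    ∣ NS G U ∣ ≤ ∣ NS G S ∣ × ∣ NS G U ∣ ≤ ∣ NS G T ∣
  pick-≤ (yes b) = ≤-refl , [ <⇒≤ , ≤-reflexive ∘ proj₁ ]′ b
  pick-≤ (no ¬b) = ≮⇒≥ (¬b ∘ inj₁) , ≤-refl

  best-minimal : ∀ S Ss {T} → T ∈ S ∷ Ss → ∣ NS G (best S Ss) ∣ ≤ ∣ NS G T ∣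
  best-minimal S []       (here refl)         = ≤-refl
  best-minimal S (U ∷ Us) (here refl)         = ≤-trans (proj₂ (pick-≤ (better? U (best S Us)))) (best-minimal S Us (here refl))
  best-minimal S (U ∷ Us) (there (here refl)) = proj₁ (pick-≤ (better? U (best S Us)))
  best-minimal S (U ∷ Us) (there (there T∈))  = ≤-trans (proj₂ (pick-≤ (better? U (best S Us)))) (best-minimal S Us (there T∈))

  ∈-candidates⁺ : ∀ c {g T} → T ⊆ˢ g → ∣ T ∣ ≡ suc c → T ∈ candidates c g
  ∈-candidates⁺ c {g} {T} T⊆g ∣T∣ = ∈-filter⁺ (λ S → (S ⊆? g) ×-dec (∣ S ∣ ≟ suc c)) (∈-subsets T) (T⊆g , ∣T∣)

  ∈-candidates⁻ : ∀ c {g T} → T ∈ candidates c g → T ⊆ˢ g × ∣ T ∣ ≡ suc c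
  ∈-candidates⁻ c {g} T∈ = proj₂ (∈-filter⁻ (λ S → (S ⊆? g) ×-dec (∣ S ∣ ≟ suc c)) {xs = subsets n} T∈)

  -- If `c ≤ i`, then `T` is itself a candidate and `best` is at least as good. Otherwise `T` has as
  -- many vertices as `g`, so it equals `g`, which is then its own representative.
  D-minimal : ∀ c {i g T} → ∣ g ∣ ≡ suc i → T ⊆ˢ g → ∣ T ∣ ≡ suc (c ⊓ i) → D c g ≤ ∣ NS G T ∣
  D-minimal c {i} {g} {T} ∣g∣ T⊆g ∣T∣ with candidates c g in eq | c ≤? i
  ... | []     | yes c≤i
    with () ← subst (T ∈_) eq (∈-candidates⁺ c T⊆g (trans ∣T∣ (cong suc (m≤n⇒m⊓n≡m c≤i))))
  ... | []     | no c≰i = ≤-reflexive (cong (∣_∣ ∘ NS G) (sym (⊆∧∣∣≡⇒≡ T⊆g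
    (trans ∣T∣ (trans (cong suc (m≥n⇒m⊓n≡n (<⇒≤ (≰⇒> c≰i)))) (sym ∣g∣))))))
  ... | S ∷ Ss | yes c≤i = best-minimal S Ss
    (subst (T ∈_) eq (∈-candidates⁺ c T⊆g (trans ∣T∣ (cong suc (m≤n⇒m⊓n≡m c≤i)))))
  -- A candidate would have `suc c` vertices inside `g`, which has only `suc i`.
  ... | S ∷ Ss | no c≰i
    with S⊆g , ∣S∣ ← ∈-candidates⁻ c (subst (S ∈_) (sym eq) (here refl)) =
    contradiction (≤-pred (subst₂ _≤_ ∣S∣ ∣g∣ (p⊆q⇒∣p∣≤∣q∣ S⊆g))) c≰i

-- Counting copies by the heads of their paths.

module _ {n : ℕ} (G : Graph (Fin n)) {α : ℕ} (orientation : Orientation G α) where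

  private
    parent = proj₁ orientation
    V = allFin n

    orient : ∀ {u v} → Adj G u v → Step parent u v ⊎ Step parent v u
    orient u~v with proj₂ orientation u~v
    ... | j , inj₁ eq = inj₁ (j , eq)
    ... | j , inj₂ eq = inj₂ (j , eq)

  -- The vertex sets of s + 1 walks with r steps in total, the first one from v.
  spans : ℕ → ℕ → Fin n → List (Subset n)
  spans s r v = concatMap (λ us → map (λ ws → fromList ((v ∷ us) ++ ws)) (walks parent r (v ∷ us))) (lists V s)

  length-spans : ∀ s r v → length (spans s r v) ≤ n ^ s * (suc s * α) ^ r
  length-spans s r v = begin
    length (spans s r v)                       ≤⟨ length-concatMap _ (lists V s) (λ {us} us∈ → ≤-trans
      (≤-reflexive (length-map _ (walks parent r (v ∷ us))))
      (subst (λ l → length (walks parent r (v ∷ us)) ≤ (suc l * α) ^ r) (∈-lists⇒length V s us∈) (length-walks parent r (v ∷ us)))) ⟩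
    length (lists V s) * (suc s * α) ^ r       ≤⟨ *-monoˡ-≤ _ (length-lists V s) ⟩
    length V ^ s * (suc s * α) ^ r             ≡⟨ cong (λ l → l ^ s * (suc s * α) ^ r) (length-tabulate {n = n} id) ⟩
    n ^ s * (suc s * α) ^ r                    ∎
    where open ≤-Reasoning

  -- The heads and tails together are a permutation of `S`, so `S` is recovered from them; comparing
  -- lengths shows that the tails contain exactly `r` vertices.
  headed⇒∈-spans : ∀ {s r S v xs ps} → ∣ S ∣ ≡ suc s + r → length ((v , xs) ∷ ps) ≡ suc s →
    All (IsDipath (adj? G) {Step parent} orient) ((v , xs) ∷ ps) → flat ((v , xs) ∷ ps) ↭ elements S → S ∈ spans s r v
  headed⇒∈-spans {s} {r} {S} {v} {xs} {ps} ∣S∣ len psl ps↭ = ∈-concatMap⁺ _ (lose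
    (subst (λ l → heads ps ∈ lists V l) ∣hs∣ (∈-lists (heads ps) (λ _ → ∈-allFin _)))
    (subst (_∈ _) (sym S≡) (∈-map⁺ _ (subst (λ l → ts ∈ walks parent l (v ∷ heads ps)) ∣ts∣ (tails∈walks parent ((v , xs) ∷ ps) psl)))))
    where
    ts = tails ((v , xs) ∷ ps)
    perm : (v ∷ heads ps) ++ ts ↭ elements S
    perm = ↭-trans (↭-sym (flat↭heads++tails ((v , xs) ∷ ps))) ps↭
    ∣hs∣ : length (heads ps) ≡ s
    ∣hs∣ = trans (length-map proj₁ ps) (cong pred len)
    ∣ts∣ : length ts ≡ r
    ∣ts∣ = +-cancelˡ-≡ (suc s) _ _ (begin
      suc s + length ts                    ≡⟨ cong (λ l → suc l + length ts) ∣hs∣ ⟨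
      length (v ∷ heads ps) + length ts    ≡⟨ length-++ (v ∷ heads ps) ⟨
      length ((v ∷ heads ps) ++ ts)        ≡⟨ ↭-length perm ⟩
      length (elements S)                  ≡⟨ length-elements S ⟩
      ∣ S ∣                                ≡⟨ ∣S∣ ⟩
      suc s + r                            ∎)
      where open ≡-Reasoning
    S≡ : S ≡ fromList ((v ∷ heads ps) ++ ts)
    S≡ = ⊆-antisym (∈-fromList⁺ ∘ ∈-resp-↭ (↭-sym perm) ∘ ∈-elements⁺ {S = S})
                   (∈-elements⁻ {S = S} ∘ ∈-resp-↭ perm ∘ ∈-fromList⁻)

  -- `T` consists of the heads of a partition into `suc s` paths. Degree at least `r` in a set of
  -- `suc s + r` vertices is exactly the density that `dipath-partition` asks for.
  spanning-heads : ∀ {s r S} → ∣ S ∣ ≡ suc s + r → (∀ {w} → w ∈ˢ S → r ≤ ∣ N G w ∩ S ∣) →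
    ∃ λ T → T ⊆ˢ S × ∣ T ∣ ≡ suc s × (∀ {v} → v ∈ˢ T → S ∈ spans s r v)
  spanning-heads {s} {r} {S} ∣S∣ dense =
    fromList hs ,
    ∈-elements⁻ {S = S} ∘ ∈-resp-↭ perm ∘ ∈-++⁺ˡ ∘ ∈-fromList⁻ {xs = hs} ,
    trans (∣fromList∣ (Unique-++⁻ˡ hs (Unique-resp-↭ (↭-sym perm) (Unique-elements S)))) (trans (length-map proj₁ paths) size) ,
    λ v∈ → let xs , ps , len , psl , ps↭ = headed-by (adj? G) orient 𝒫 (∈-fromList⁻ {xs = hs} v∈) in
      headed⇒∈-spans ∣S∣ len psl ps↭
    where
    ∣es∣ : length (elements S) ≡ suc s + r
    ∣es∣ = trans (length-elements S) ∣S∣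
    degree≤ : ∀ w → ∣ N G w ∩ S ∣ ≤ length (filter (adj? G w) (elements S))
    degree≤ w = ≤-trans (≤-reflexive (sym (length-elements (N G w ∩ S)))) (Unique-⊆-length (Unique-elements (N G w ∩ S))
      λ u∈ → let u∈N , u∈S = x∈p∩q⁻ (N G w) S (∈-elements⁻ u∈) in
        ∈-filter⁺ (adj? G w) (∈-elements⁺ u∈S) (∈-tabulate-does⁻ (adj? G w) u∈N))
    𝒫 = dipath-partition (adj? G) orient (Graph.~-irrefl G refl) {m = suc s} {es = elements S}
      (≤-trans (m≤m+n (suc s) r) (≤-reflexive (sym ∣es∣)))
      λ {w} w∈ → ≤-trans (≤-reflexive (trans ∣es∣ (+-comm (suc s) r)))
        (+-monoˡ-≤ (suc s) (≤-trans (dense (∈-elements⁻ w∈)) (degree≤ w)))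
    open DipathPartition 𝒫
    hs = heads paths
    perm : hs ++ tails paths ↭ elements S
    perm = ↭-trans (↭-sym (flat↭heads++tails paths)) cover

  open import Data.List.Membership.DecPropositional {A = Subset n} (Vec.≡-dec Bool._≟_) using () renaming (_∈?_ to _∈L?_)

  sum-D≤ : ∀ s r (D : Subset n → ℕ) L → Unique L →
    (∀ {S} → S ∈ L → ∃ λ T → D S ≤ ∣ NS G T ∣ × (∀ {v} → v ∈ˢ T → S ∈ spans s r v)) →
    ∀ {X} → (Fin n → n ^ s * (suc s * α) ^ r ≤ X) → sum (map D L) ≤ 2 * edgeCount G * X
  sum-D≤ s r D L L! bound {X} ≤X = begin
    sum (map D L)                                                   ≤⟨ sum-map-mono L D≤ ⟩
    sum (map (λ S → sum (map d (filter (λ v → S ∈L? spans s r v) V))) L) ≡⟨ double-count (λ S v → S ∈L? spans s r v) d L V ⟩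
    sum (map (λ v → d v * length (filter (λ S → S ∈L? spans s r v) L)) V) ≤⟨ sum-map-mono V (λ {v} _ → *-monoʳ-≤ (d v) (few v)) ⟩
    sum (map (λ v → d v * X) V)                                     ≡⟨ sum-map-*ʳ d X V ⟩
    sum (map d V) * X                                               ≤⟨ *-monoˡ-≤ X (handshake G) ⟩
    2 * edgeCount G * X                                             ∎
    where
    open ≤-Reasoning
    d = ∣_∣ ∘ N G
    D≤ : ∀ {S} → S ∈ L → D S ≤ sum (map d (filter (λ v → S ∈L? spans s r v) V))
    D≤ S∈ with T , le , ∈spans ← bound S∈ = ≤-trans le (≤-trans (∣NS∣≤sum G T)
      (sum-map-filter-mono (_∈ˢ? T) (λ v → _ ∈L? spans s r v) d ∈spans V))
    -- As `L` has no repetitions, it contains at most as many members of `spans s r v` as that list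
    -- has entries.
    few : ∀ v → length (filter (λ S → S ∈L? spans s r v) L) ≤ X
    few v = ≤-trans (Unique-⊆-length (Unique-filter⁺ in? L!) (proj₂ ∘ ∈-filter⁻ in? {xs = L}))
      (≤-trans (length-spans s r v) (≤X v))
      where in? = λ S → S ∈L? spans s r v

-- Assembly of the bound.

lemma2p4 : ∀ {n : ℕ} (G : Graph (Fin n))
    {_≺_ : Fin n → Fin n → Set} (≺-sto : IsStrictTotalOrder _≡_ _≺_)
    (α : ℕ) → IsArboricity G α →
    ∀ {k : ℕ} (ζ : Graph (Fin k)) (c : ℕ) (σ : ℕ → Subset k) →
    IsSegmentation ζ σ → IsDense c ζ σ →
    ∀ (i : ℕ) → 2 ≤ i → i ≤ k →
    sum (map (Representative.D G ≺-sto c) (𝒢 G ζ (σ i)))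
    ≤ 2 * edgeCount G * ((c + 1) * α) ^ (i ∸ 1 ∸ c) * n ^ c
lemma2p4 {n} G ≺-sto α (FP , _) {k} ζ c σ seg dense (suc i) 2≤i i≤k = begin
  sum (map D L)                                            ≤⟨ sum-D≤ G orientation s r D L L! bound ≤X ⟩
  2 * edgeCount G * (((c + 1) * α) ^ r * n ^ c)            ≡⟨ *-assoc (2 * edgeCount G) _ _ ⟨
  2 * edgeCount G * ((c + 1) * α) ^ r * n ^ c              ∎
  where
  open ≤-Reasoning
  orientation = forests⇒orientation G FP
  D = Representative.D G ≺-sto c
  -- A copy has `suc i` vertices here, of which `suc s` are heads and `r` are reached by steps. The
  -- minimum treats both cases at once: for `i ≤ c` every vertex is a head and `r` is 0.
  s = c ⊓ i
  r = i ∸ c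
  copy? = λ S → isomorphic? (members↔ S) (members↔ (σ (suc i))) (G [ S ]) (ζ [ σ (suc i) ])
  L = 𝒢 G ζ (σ (suc i))
  L! : Unique L
  L! = Unique-filter⁺ copy? (Unique-subsets n)
  bound : ∀ {S} → S ∈ L → ∃ λ T → D S ≤ ∣ NS G T ∣ × (∀ {v} → v ∈ˢ T → S ∈ spans G orientation s r v)
  bound {S} S∈ =
    let T , T⊆S , ∣T∣ , ∈spans = spanning-heads G orientation {s} {r} {S}
          (trans ∣S∣ (cong suc (sym (m⊓n+n∸m≡n c i)))) degree
    in T , D-minimal G ≺-sto c ∣S∣ T⊆S ∣T∣ , ∈spans
    where
    iso = proj₂ (∈-filter⁻ copy? {xs = subsets n} S∈)
    ∣S∣ : ∣ S ∣ ≡ suc i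
    ∣S∣ = trans (≅⇒∣∣≡ G ζ iso) (IsSegmentation.size seg (suc i) 2≤i i≤k)
    degree : ∀ {w} → w ∈ˢ S → r ≤ ∣ N G w ∩ S ∣
    degree {w} w∈ = let v , v∈ = Inverse.to (_≅_.bijection iso) (w , w∈) in
      ≤-trans (dense (suc i) 2≤i i≤k v v∈) (≅⇒degree G ζ iso (w , w∈))
  -- A vertex is needed because n ^ s ≤ n ^ c fails for n = 0 and s = 0 < c.
  ≤X : Fin n → n ^ s * (suc s * α) ^ r ≤ ((c + 1) * α) ^ r * n ^ c
  ≤X v = ≤-trans (≤-reflexive (*-comm (n ^ s) _)) (*-mono-≤
    (^-monoˡ-≤ r (*-monoˡ-≤ α (≤-trans (s≤s (m⊓n≤m c i)) (≤-reflexive (+-comm 1 c)))))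
    (^-monoʳ-≤ n ⦃ Fin.nonZeroIndex v ⦄ (m⊓n≤m c i)))
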